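{- Every graph $G$ whose colouring number $\operatorname{col}(G)$ is infinite possesses a good well-ordering of its vertex set whose length (order type) is the cardinal $|V(G)|$.
   Context: Graphs are simple and undirected, possibly infinite; $N(v)$ denotes the set of neighbours of a vertex $v$. The colouring number $\operatorname{col}(G)$ of a graph $G=(V,E)$ is the smallest cardinal $\kappa$ such that there exists a well-ordering $<^*$ of $V$ with $|N(v)\cap\{w : w<^* v\}|<\kappa$ for all $v\in V$. Well-orderings of $V$ with this property for $\kappa=\operatorname{col}(G)$ are called good. A cardinal is identified with its initial ordinal, so a well-ordering of length $|V(G)|$ is one whose order type is this initial ordinal. -}

module Defs where

open import Data.Fin.Base using (Fin)
open import Data.Nat.Base using (ℕ)
open import Data.Product using (∃-syntax; _×_)
open import Data.Refinement using (Refinement-syntax)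
open import Function.Bundles using (_↣_; _⤖_)
open import Induction.WellFounded using (WellFounded)
open import Level using (Level; _⊔_; suc)
open import Relation.Binary.Core using (Rel)
open import Relation.Binary.Definitions using (Irreflexive; Symmetric)
open import Relation.Binary.Morphism.Structures using (IsOrderIsomorphism)
open import Relation.Binary.PropositionalEquality using (_≡_)
open import Relation.Binary.Structures using (IsStrictTotalOrder)
open import Relation.Nullary using (¬_)

private
  variable
    a b ℓ : Level

-- Subsets are written [ x ∈ A ∣ P x ]; this is the library's refinement type,
-- whose membership proof is irrelevant.  Two of its elements are thus equal as
-- soon as their values are, so that injections and bijections between subsets
-- compare numbers of elements and not numbers of proofs.

record Graph ℓ : Set (suc ℓ) where
  infix 4 _~_
  field
    Vertex   : Set ℓ
    _~_      : Rel Vertex ℓ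
    ~-sym    : Symmetric _~_
    ~-irrefl : Irreflexive _≡_ _~_

Infinite : Set a → Set a
Infinite A = ∀ (n : ℕ) → ¬ (A ⤖ Fin n)

infix 4 _≼_ _≺_

_≼_ : Set a → Set b → Set (a ⊔ b)
A ≼ B = A ↣ B

_≺_ : Set a → Set b → Set (a ⊔ b)
A ≺ B = A ≼ B × ¬ (B ≼ A)

record WellOrdering (A : Set ℓ) : Set (suc ℓ) where
  infix 4 _<_
  field
    _<_                : Rel A ℓ
    isStrictTotalOrder : IsStrictTotalOrder _≡_ _<_
    wellFounded        : WellFounded _<_

-- An initial ordinal.  The ordinals below the order type of a well-ordered set
-- are, up to isomorphism, its proper initial segments.

record Cardinal ℓ : Set (suc ℓ) where
  field
    Carrier      : Set ℓ
    wellOrdering : WellOrdering Carrier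
  open WellOrdering wellOrdering public
  field
    initial : ∀ x → ¬ ([ y ∈ Carrier ∣ y < x ] ⤖ Carrier)

open Cardinal using (Carrier)

_IsCardinalityOf_ : Cardinal ℓ → Set ℓ → Set ℓ
κ IsCardinalityOf A = Carrier κ ⤖ A

_HasOrderType_ : {A : Set ℓ} → WellOrdering A → Cardinal ℓ → Set ℓ
_HasOrderType_ {A = A} W κ =
  ∃[ f ] IsOrderIsomorphism {A = A} {B = Carrier κ} _≡_ _≡_ W._<_ κ._<_ f
  where
  module W = WellOrdering W
  module κ = Cardinal κ

module _ (G : Graph ℓ) where
  open Graph G

  EarlierNeighbours : WellOrdering Vertex → Vertex → Set ℓ
  EarlierNeighbours W v = [ w ∈ Vertex ∣ (v ~ w × w < v) ]
    where open WellOrdering W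

  FewerEarlierNeighboursThan : Cardinal ℓ → WellOrdering Vertex → Set ℓ
  FewerEarlierNeighboursThan κ W = ∀ v → EarlierNeighbours W v ≺ Carrier κ

  -- Restricting to cardinals in the universe of the vertex set loses nothing:
  -- the colouring number is at most the number of vertices.

  record IsColouringNumber (κ : Cardinal ℓ) : Set (suc ℓ) where
    field
      attained : ∃[ W ] FewerEarlierNeighboursThan κ W
      smallest : ∀ μ → (∃[ W ] FewerEarlierNeighboursThan μ W) →
                 Carrier κ ≼ Carrier μ

  Good : WellOrdering Vertex → Set (suc ℓ)
  Good W = ∃[ κ ] (IsColouringNumber κ × FewerEarlierNeighboursThan κ W)

{-# OPTIONS --safe #-}
module Submission where

open import Defs
open import Axiom.DoubleNegationElimination using (em⇒dne)
open import Axiom.ExcludedMiddle using (ExcludedMiddle)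
open import Axiom.Extensionality.Propositional using (Extensionality; lower-extensionality)
open import Data.Empty using (⊥-elim; ⊥-elim-irr)
open import Data.Fin.Base as Fin using (Fin; fromℕ<; punchOut)
open import Data.Fin.Properties
  using (fromℕ<-injective; punchOut-injective; suc-injective; *↔×; ℕ→Fin-notInjective)
open import Data.Irrelevant using ([_])
open import Data.List.Base using (List; []; _∷_)
import Data.List.Properties as List
open import Data.Maybe.Base using (Maybe; just; nothing)
import Data.Maybe.Properties as Maybe
open import Data.Nat.Base as ℕ using (ℕ)
import Data.Nat.Induction as ℕ
import Data.Nat.Properties as ℕ
open import Data.Product using (∃-syntax; Σ-syntax; _×_; _,_; proj₁; proj₂; uncurry)
open import Data.Product.Function.NonDependent.Propositional using (_×-↣_)
open import Data.Product.Properties using (,-injectiveˡ; ,-injectiveʳ)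
open import Data.Product.Relation.Binary.Lex.Strict using (×-Lex; ×-isStrictTotalOrder; ×-wellFounded)
open import Data.Product.Relation.Binary.Pointwise.NonDependent using (≡×≡⇒≡; ≡⇒≡×≡)
open import Data.Refinement using (Refinement-syntax; value; value-injective; _,_)
open import Data.Sum.Base using (_⊎_; inj₁; inj₂)
open import Function.Base using (_∘_; _on_; id)
open import Function.Bundles using (_↣_; _⤖_; Injection; mk↣; mk⤖)
open import Function.Construct.Composition using (_↣-∘_)
open import Function.Definitions using (Injective)
open import Function.Properties.Bijection using (⤖⇒↔)
open import Function.Properties.Inverse using (↔-sym; ↔⇒↣)
open import Induction.WellFounded using (WfRec; module All; module FixPoint)
open import Level using (Level; Lift; lift; lower; _⊔_; suc)
open import Relation.Binary.Construct.Closure.ReflexiveTransitive using (Star; ε; _◅_; _◅◅_)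
import Relation.Binary.Construct.On as On
open import Relation.Binary.Core using (Rel)
open import Relation.Binary.Definitions using (Trichotomous; tri<; tri≈; tri>)
import Relation.Binary.Morphism.Construct.Identity as Identity
open import Relation.Binary.PropositionalEquality
  using (_≡_; _≢_; refl; sym; trans; cong; isEquivalence)
open import Relation.Binary.Structures using (IsStrictTotalOrder)
open import Relation.Binary.Structures.Biased using (isStrictTotalOrderᶜ)
open import Relation.Nullary.Decidable using (Dec; yes; no; map′; recompute)
open import Relation.Nullary.Negation using (¬_; contradiction)

open Injection using (to; injective)

-- Let κ be the colouring number, W a good well-ordering and W₀ a well-ordering
-- of V of length |V|; if |V| ≤ κ, then W₀ is already good.  Otherwise let root v
-- be the W₀-least vertex from which a W-descending path leads to v, and order V
-- first by root in W₀ and then by W.  If w ~ v comes earlier in this order but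
-- v < w in W, then root w also reaches v, so that root v ≤ root w, a
-- contradiction; hence the new order is good.  As the vertices reached from one
-- root are coded by finite sequences in κ, a proper
-- initial segment has at most μ · κ elements for some μ < |V|, hence fewer than
-- |V| by Hessenberg's theorem.

private
  variable
    a b ℓ : Level
    A : Set a
    B : Set b

-- Well-orderings, their segments, and embeddings by recursion.

lower-em : ExcludedMiddle (suc ℓ) → ExcludedMiddle ℓ
lower-em {ℓ} em {P} = map′ lower lift (em {Lift (suc ℓ) P})

⤖⇒≽ : A ⤖ B → B ≼ A
⤖⇒≽ f = ↔⇒↣ (↔-sym (⤖⇒↔ f))

module Order {A : Set a} (W : WellOrdering A) where
  open WellOrdering W public
  open IsStrictTotalOrder isStrictTotalOrder public
    using (compare; irrefl; asym) renaming (trans to <-trans)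

  Segment : A → Set a
  Segment x = [ y ∈ A ∣ y < x ]

  ClosedSegment : A → Set a
  ClosedSegment x = [ y ∈ A ∣ ¬ (x < y) ]

  segment⊂ : ∀ x → Segment x ≼ A
  segment⊂ x = mk↣ value-injective

  closedSegment⊂ : ∀ x → ClosedSegment x ≼ A
  closedSegment⊂ x = mk↣ value-injective

  ≤⇒<⊎≡ : ∀ {x y} → ¬ (y < x) → x < y ⊎ x ≡ y
  ≤⇒<⊎≡ {x} {y} y≮x with compare x y
  ... | tri< x<y _ _ = inj₁ x<y
  ... | tri≈ _ x≡y _ = inj₂ x≡y
  ... | tri> _ _ y<x = contradiction y<x y≮x

  <-≤-trans : ∀ {x y z} → x < y → ¬ (z < y) → x < z
  <-≤-trans x<y z≮y with ≤⇒<⊎≡ z≮y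
  ... | inj₁ y<z = <-trans x<y y<z
  ... | inj₂ refl = x<y

  max : A → A → A
  max x y with compare x y
  ... | tri< _ _ _ = y
  ... | tri≈ _ _ _ = x
  ... | tri> _ _ _ = x

  max-≥ˡ : ∀ x y → ¬ (max x y < x)
  max-≥ˡ x y with compare x y
  ... | tri< x<y _ y≮x = y≮x
  ... | tri≈ _ _ _ = irrefl refl
  ... | tri> _ _ _ = irrefl refl

  max-≥ʳ : ∀ x y → ¬ (max x y < y)
  max-≥ʳ x y with compare x y
  ... | tri< _ _ _ = irrefl refl
  ... | tri≈ x≮y _ _ = x≮y
  ... | tri> x≮y _ _ = x≮y

  -- Excluding injections rather than bijections lets initiality combine with embeddings without the
  -- Schröder-Bernstein theorem.
  Initial : Set a
  Initial = ∀ x → ¬ (A ≼ Segment x)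

pullback : {A B : Set a} → A ≼ B → WellOrdering B → WellOrdering A
pullback {A = A} f W = record
  { _<_ = _<_ on to f
  ; isStrictTotalOrder = isStrictTotalOrderᶜ record
    { isEquivalence = isEquivalence
    ; trans = <-trans
    ; compare = compare-on
    }
  ; wellFounded = On.wellFounded (to f) wellFounded
  }
  where
  open Order W
  compare-on : Trichotomous _≡_ (_<_ on to f)
  compare-on x y with compare (to f x) (to f y)
  ... | tri< x<y x≢y y≮x = tri< x<y (x≢y ∘ cong (to f)) y≮x
  ... | tri≈ x≮y x≡y y≮x = tri≈ x≮y (injective f x≡y) y≮x
  ... | tri> x≮y x≢y y<x = tri> x≮y (x≢y ∘ cong (to f)) y<x

pullback-segment : {A B : Set a} (f : A ≼ B) (W : WellOrdering B) → ∀ x →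
                   Order.Segment (pullback f W) x ≼ Order.Segment W (to f x)
pullback-segment f W x = mk↣ {to = λ { (y , [ y<x ]) → to f y , [ y<x ] }}
  (value-injective ∘ injective f ∘ cong value)

lexicographic : {A B : Set a} → WellOrdering A → WellOrdering B → WellOrdering (A × B)
lexicographic V W = record
  { _<_ = ×-Lex _≡_ V._<_ W._<_
  ; isStrictTotalOrder = isStrictTotalOrderᶜ record
    { isEquivalence = isEquivalence
    ; trans = λ {i} {j} {k} → IsStrictTotalOrder.trans lex {i} {j} {k}
    ; compare = compare-≡
    }
  ; wellFounded = ×-wellFounded V.wellFounded W.wellFounded
  }
  where
  module V = Order V
  module W = Order W
  lex = ×-isStrictTotalOrder V.isStrictTotalOrder W.isStrictTotalOrder
  compare-≡ : Trichotomous _≡_ (×-Lex _≡_ V._<_ W._<_)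
  compare-≡ x y with IsStrictTotalOrder.compare lex x y
  ... | tri< x<y x≢y y≮x = tri< x<y (x≢y ∘ ≡⇒≡×≡) y≮x
  ... | tri≈ x≮y x≡y y≮x = tri≈ x≮y (≡×≡⇒≡ x≡y) y≮x
  ... | tri> x≮y x≢y y<x = tri> x≮y (x≢y ∘ ≡⇒≡×≡) y<x

ℕ-order : WellOrdering ℕ
ℕ-order = record
  { _<_ = ℕ._<_
  ; isStrictTotalOrder = ℕ.<-isStrictTotalOrder
  ; wellFounded = ℕ.<-wellFounded
  }

-- Enumerate B along W, picking at each x a value not yet taken; one is left
-- because the values taken so far embed into a proper segment.
module Embedding {a b} {A : Set a} {B : Set b}
  (em : ExcludedMiddle (a ⊔ b)) (ext : Extensionality (a ⊔ b) (a ⊔ b))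
  (W : WellOrdering A) (B⋠ : ∀ x → ¬ (B ≼ Order.Segment W x)) where
  open Order W

  Hit : ∀ {x} → (∀ y → y < x → B) → B → Set (a ⊔ b)
  Hit {x} g z = ∃[ y ] Σ[ y<x ∈ y < x ] (g y y<x ≡ z)

  inhabitant : A → B
  inhabitant x with em {Lift a B}
  ... | yes (lift z) = z
  ... | no ¬B = ⊥-elim (B⋠ x (mk↣ {to = ⊥-elim ∘ ¬B ∘ lift} λ {z} _ → ⊥-elim (¬B (lift z))))

  fresh : ∀ x → (∀ y → y < x → B) → B
  fresh x g with em {∃[ z ] ¬ Hit g z}
  ... | yes (z , _) = z
  -- A default value: `g` may depend on the proofs of `y < x` and so might hit all of `B`. For the
  -- restriction of a function on `A`, `fresh-unhit` excludes this case.
  ... | no _ = inhabitant x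

  fresh-unhit : ∀ x (f : A → B) → ¬ Hit {x} (λ y _ → f y) (fresh x (λ y _ → f y))
  fresh-unhit x f with em {∃[ z ] ¬ Hit {x} (λ y _ → f y) z}
  ... | yes (_ , unhit) = unhit
  ... | no all-hit = ⊥-elim (B⋠ x (mk↣ {to = preimage} λ {z} {z′} eq →
      trans (sym (proj₂ (proj₂ (hit z)))) (trans (cong (f ∘ value) eq) (proj₂ (proj₂ (hit z′))))))
    where
    hit : ∀ z → Hit {x} (λ y _ → f y) z
    hit z = em⇒dne em λ unhit → all-hit (z , unhit)
    preimage : B → Segment x
    preimage z = proj₁ (hit z) , [ proj₁ (proj₂ (hit z)) ]

  step : ∀ x → WfRec _<_ (λ _ → B) x → B
  step x g = fresh x (λ y y<x → g y<x)

  step-ext : ∀ x {g h : WfRec _<_ (λ _ → B) x} → (∀ {y} y<x → g {y} y<x ≡ h y<x) → step x g ≡ step x h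
  step-ext x eq = cong (fresh x)
    (lower-extensionality b (a ⊔ b) ext λ y → lower-extensionality b a ext (eq {y}))

  f : A → B
  f = All.wfRec wellFounded b (λ _ → B) step

  f-unhit : ∀ {x y} → y < x → f y ≢ f x
  f-unhit {x} {y} y<x eq = fresh-unhit x f
    (y , y<x , trans eq (FixPoint.unfold-wfRec wellFounded (λ _ → B) step step-ext))

  embedding : A ≼ B
  embedding = mk↣ {to = f} f-injective
    where
    f-injective : Injective _≡_ _≡_ f
    f-injective {x} {y} eq with compare x y
    ... | tri< x<y _ _ = contradiction eq (f-unhit x<y)
    ... | tri≈ _ x≡y _ = x≡y
    ... | tri> _ _ y<x = contradiction (sym eq) (f-unhit y<x)

open Embedding using (embedding)

-- Finite sets.

-- By induction on `n`, punching out a missed value. It is meant for `Infinite`, which excludes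
-- bijections with `Fin` and not injections into it.
finite⇒⤖ : ExcludedMiddle a → {A : Set a} → ∀ n → A ≼ Fin n → ∃[ m ] (A ⤖ Fin m)
finite⇒⤖ em n f with em {∃[ i ] (∀ x → to f x ≢ i)}
... | no surj = n , mk⤖ (injective f , λ i →
        let x , fx≡i = em⇒dne em (λ ∄x → surj (i , λ x fx≡i → ∄x (x , fx≡i)))
        in x , λ { refl → fx≡i })
finite⇒⤖ em (ℕ.suc n) f | yes (i , f≢i) =
  finite⇒⤖ em n (mk↣ {to = λ x → punchOut (f≢i x ∘ sym)} λ {x} {y} eq →
    injective f (punchOut-injective (f≢i x ∘ sym) (f≢i y ∘ sym) eq))

ℕ⋠Fin : ∀ {n} → ¬ (ℕ ≼ Fin n)
ℕ⋠Fin f = ℕ→Fin-notInjective (to f) (injective f)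

Maybe-≼ : A ≼ B → Maybe A ≼ Maybe B
Maybe-≼ f = mk↣ (Maybe.map-injective (injective f))

Maybe-Fin≼ : ∀ {n} → Maybe (Fin n) ≼ Fin (ℕ.suc n)
Maybe-Fin≼ {n} = mk↣ {to = g} g-injective
  where
  g : Maybe (Fin n) → Fin (ℕ.suc n)
  g nothing = Fin.zero
  g (just i) = Fin.suc i
  g-injective : Injective _≡_ _≡_ g
  g-injective {nothing} {nothing} _ = refl
  g-injective {just _} {just _} eq = cong just (suc-injective eq)

-- Arithmetic of infinite cardinals.

module Cardinality {ℓ} (em : ExcludedMiddle ℓ) (ext : Extensionality ℓ ℓ) where

  dne : {P : Set ℓ} → ¬ ¬ P → P
  dne = em⇒dne em

  -- Excluded middle decides the property, so the irrelevant membership proof can be recomputed into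
  -- a usable one.
  holds : {A : Set ℓ} {P : A → Set ℓ} (s : [ x ∈ A ∣ P x ]) → P (value s)
  holds (_ , [ p ]) = recompute em p

  ≼-total : {A B : Set ℓ} → WellOrdering A → A ≼ B ⊎ B ≼ A
  ≼-total {A} {B} W with em {∃[ x ] (B ≼ Order.Segment W x)}
  ... | yes (x , f) = inj₂ (Order.segment⊂ W x ↣-∘ f)
  ... | no B⋠ = inj₁ (embedding em ext W λ x f → B⋠ (x , f))

  -- The comparison of `≼-total` with the natural numbers as the ordered set, whose proper segments
  -- are finite.
  finite-or-infinite : (B : Set ℓ) → (∃[ n ] (B ≼ Fin n)) ⊎ (ℕ ≼ B)
  finite-or-infinite B with em {∃[ n ] (B ≼ Order.Segment ℕ-order n)}
  ... | yes (n , f) = inj₁ (n , mk↣ {to = λ { (_ , [ m<n ]) → fromℕ< m<n }}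
          (λ { {_ , [ p ]} {_ , [ q ]} eq → value-injective (fromℕ<-injective _ _ p q eq) }) ↣-∘ f)
  ... | no B⋠ = inj₂ (embedding em ext ℕ-order λ n f → B⋠ (n , f))

  -- Hilbert's hotel: shifting the sequence `e` by one place frees `to e 0` for `nothing`.
  Maybe≼ : {X : Set ℓ} → ℕ ≼ X → Maybe X ≼ X
  Maybe≼ {X} e = mk↣ {to = g} g-injective
    where
    Index : X → Set ℓ
    Index x = ∃[ n ] (to e n ≡ x)
    -- The decision is an argument so that injectivity can be proved by cases on it.
    shift : ∀ x → Dec (Index x) → X
    shift x (yes (n , _)) = to e (ℕ.suc n)
    shift x (no _) = x
    shift-injective : ∀ {x y} d d′ → shift x d ≡ shift y d′ → x ≡ y
    shift-injective (yes (_ , refl)) (yes (_ , refl)) eq = cong (to e) (ℕ.suc-injective (injective e eq))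
    shift-injective (yes (n , _)) (no ∄) eq = contradiction (ℕ.suc n , eq) ∄
    shift-injective (no ∄) (yes (n , _)) eq = contradiction (ℕ.suc n , sym eq) ∄
    shift-injective (no _) (no _) eq = eq
    shift≢0 : ∀ {x} d → to e 0 ≢ shift x d
    shift≢0 (yes (n , _)) eq with injective e eq
    ... | ()
    shift≢0 (no ∄) eq = ∄ (0 , eq)
    g : Maybe X → X
    g nothing = to e 0
    g (just x) = shift x em
    g-injective : Injective _≡_ _≡_ g
    g-injective {nothing} {nothing} _ = refl
    g-injective {nothing} {just _} eq = contradiction eq (shift≢0 em)
    g-injective {just _} {nothing} eq = contradiction (sym eq) (shift≢0 em)
    g-injective {just _} {just _} eq = cong just (shift-injective em em eq)

  -- A list is empty or a head with a tail, so one injection of `Maybe (X × X)` into `X`, applied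
  -- recursively, codes lists of every length.
  List≼ : {X : Set ℓ} → ℕ ≼ X → (X × X) ≼ X → List X ≼ X
  List≼ {X} e p = mk↣ {to = code} code-injective
    where
    h : Maybe (X × X) ≼ X
    h = Maybe≼ e ↣-∘ Maybe-≼ p
    code : List X → X
    code [] = to h nothing
    code (x ∷ xs) = to h (just (x , code xs))
    code-injective : Injective _≡_ _≡_ code
    code-injective {[]} {[]} _ = refl
    code-injective {[]} {_ ∷ _} eq with injective h {nothing} {just _} eq
    ... | ()
    code-injective {_ ∷ _} {[]} eq with injective h {just _} {nothing} eq
    ... | ()
    code-injective {x ∷ xs} {y ∷ ys} eq with Maybe.just-injective (injective h {just _} {just _} eq)
    ... | eq′ with ,-injectiveˡ eq′ | code-injective {xs} {ys} (,-injectiveʳ eq′)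
    ... | refl | refl = refl

  -- Lets an extra coordinate be absorbed as one more entry of a coding sequence.
  ×-List≼ : {X : Set ℓ} → (X × List X) ≼ List X
  ×-List≼ = mk↣ {to = uncurry _∷_} λ { refl → refl }

  module _ {A : Set ℓ} (W : WellOrdering A) where
    open Order W

    closedSegment≼Maybe : ∀ x → ClosedSegment x ≼ Maybe (Segment x)
    closedSegment≼Maybe x = mk↣ {to = g} λ {y} {z} → g-injective {y} {z}
      where
      g : ClosedSegment x → Maybe (Segment x)
      g (y , [ x≮y ]) with compare y x
      ... | tri< y<x _ _ = just (y , [ y<x ])
      ... | tri≈ _ _ _ = nothing
      ... | tri> _ _ x<y = ⊥-elim-irr (x≮y x<y)
      g-injective : Injective _≡_ _≡_ g
      g-injective {y , [ p ]} {z , [ q ]} eq with compare y x | compare z x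
      ... | tri> _ _ x<y | _ = ⊥-elim-irr (p x<y)
      ... | _ | tri> _ _ x<z = ⊥-elim-irr (q x<z)
      ... | tri≈ _ refl _ | tri≈ _ refl _ = refl
      g-injective {y , [ p ]} {z , [ q ]} refl | tri< _ _ _ | tri< _ _ _ = refl

    -- The closed segment adds only `x`, so the open one is infinite too, and Hilbert's hotel
    -- absorbs `x`.
    closedSegment≼segment : ∀ x → ℕ ≼ ClosedSegment x → ClosedSegment x ≼ Segment x
    closedSegment≼segment x e with finite-or-infinite (Segment x)
    ... | inj₁ (n , f) = contradiction
            (Maybe-Fin≼ ↣-∘ (Maybe-≼ f ↣-∘ (closedSegment≼Maybe x ↣-∘ e))) ℕ⋠Fin
    ... | inj₂ e′ = Maybe≼ e′ ↣-∘ closedSegment≼Maybe x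

  -- Hessenberg's theorem on squares of infinite sets.

  -- Ranging over all infinite `C` that embed into `A` makes the induction hypothesis at a segment
  -- usable for every infinite set that fits into it.
  SquareBounded : Set ℓ → Set (suc ℓ)
  SquareBounded A = {C : Set ℓ} → C ≼ A → ℕ ≼ C → (C × C) ≼ C

  module Square {A : Set ℓ} (W : WellOrdering A)
    (IH : ∀ x → SquareBounded (Order.Segment W x)) (e : ℕ ≼ A) where
    open Order W

    -- Pairs ordered by their maximum first, so that the segment below p lies in
    -- the square of a closed segment of A.
    pairMax : A × A → A
    pairMax = uncurry max

    gödel : WellOrdering (A × A)
    gödel = pullback (mk↣ {to = λ p → pairMax p , p} ,-injectiveʳ)
      (lexicographic W (lexicographic W W))

    module G = Order gödel

    pairMax-mono : ∀ {p q} → q G.< p → ¬ (pairMax p < pairMax q)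
    pairMax-mono (inj₁ m<m′) = asym m<m′
    pairMax-mono (inj₂ (m≡m′ , _)) m′<m = irrefl (sym m≡m′) m′<m

    segment≼ : ∀ p → G.Segment p ≼ (ClosedSegment (pairMax p) × ClosedSegment (pairMax p))
    segment≼ p = mk↣ {to = λ { ((x , y) , [ q<p ]) →
        (x , [ (λ m<x → pairMax-mono {p} {x , y} q<p (<-≤-trans m<x (max-≥ˡ x y))) ])
      , (y , [ (λ m<y → pairMax-mono {p} {x , y} q<p (<-≤-trans m<y (max-≥ʳ x y))) ]) }}
      λ { {(_ , _) , _} {(_ , _) , _} eq → value-injective
            (≡×≡⇒≡ (cong (value ∘ proj₁) eq , cong (value ∘ proj₂) eq)) }

    -- Otherwise `A` embeds into the square of a closed segment. A finite one contradicts `e`; the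
    -- square of an infinite one shrinks by `IH` into an open segment, against initiality.
    initial⇒segment-small : Initial → ∀ p → ¬ (A ≼ G.Segment p)
    initial⇒segment-small initial p f with finite-or-infinite (ClosedSegment (pairMax p))
    ... | inj₁ (n , g) = ℕ⋠Fin (↔⇒↣ (↔-sym *↔×) ↣-∘ ((g ×-↣ g) ↣-∘ (segment≼ p ↣-∘ (f ↣-∘ e))))
    ... | inj₂ e′ = initial (pairMax p)
            (c≼s ↣-∘ (IH (pairMax p) c≼s e′ ↣-∘ (segment≼ p ↣-∘ f)))
      where
      c≼s = closedSegment≼segment W (pairMax p) e′

    square≼ : (A × A) ≼ A
    square≼ with em {∃[ x ] (A ≼ Segment x)}
    -- Here the induction hypothesis applies to `A` itself.
    ... | yes (x , f) = IH x f e
    -- No proper segment of `gödel` can exhaust `A`, so every pair receives a fresh element.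
    ... | no initial = embedding em ext gödel (initial⇒segment-small λ x f → initial (x , f))

  -- By induction on `x`: `C` inherits an ordering through `g`, and its segment at `c` embeds into
  -- the one at `to g c`, which lies below `x`.
  segment-squareBounded : {A : Set ℓ} (W : WellOrdering A) → ∀ x → SquareBounded (Order.Segment W x)
  squareBounded : {A : Set ℓ} (W : WellOrdering A) → SquareBounded A

  segment-squareBounded {A} W = All.wfRec wellFounded _ (SquareBounded ∘ Segment) λ x IH {C} f →
    let g = segment⊂ x ↣-∘ f
    in Square.square≼ (pullback g W) λ c h → IH (holds (to f c)) (pullback-segment g W c ↣-∘ h)
    where
    open Order W

  squareBounded W f = Square.square≼ (pullback f W) (segment-squareBounded (pullback f W))

  infinite⇒List≼ : {A : Set ℓ} → WellOrdering A → ℕ ≼ A → List A ≼ A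
  infinite⇒List≼ W e = List≼ e (squareBounded W (mk↣ id) e)

  -- Least elements and initial well-orderings.

  module _ {A : Set ℓ} (W : WellOrdering A) where
    open Order W

    minimum : (P : A → Set ℓ) → ∀ {x} → P x → ∃[ m ] (P m × (∀ y → P y → ¬ (y < m)))
    minimum P {x} = All.wfRec wellFounded ℓ (λ x → P x → Least) (λ x IH px → step x IH px) x
      where
      Least = ∃[ m ] (P m × (∀ y → P y → ¬ (y < m)))
      step : ∀ x → (∀ {y} → y < x → P y → Least) → P x → Least
      step x IH px with em {∃[ y ] (P y × y < x)}
      ... | yes (_ , py , y<x) = IH y<x py
      ... | no ∄ = x , px , λ y py y<x → ∄ (y , py , y<x)

    -- Unless `W` is already initial, embed `A` into the segment at the least possible `m` and pull
    -- `W` back. An embedding into a segment of the new ordering would give a point below `m`.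
    initial-ordering : Σ[ W₀ ∈ WellOrdering A ] Order.Initial W₀
    initial-ordering with em {∃[ x ] (A ≼ Segment x)}
    ... | no ∄ = W , λ x f → ∄ (x , f)
    ... | yes (_ , f) with minimum (λ x → A ≼ Segment x) f
    ... | m , g , least = pullback h W , λ x i →
      least _ (pullback-segment h W x ↣-∘ i) (holds (to g x))
      where h = segment⊂ m ↣-∘ g

-- Good well-orderings that are initial.

module _ {ℓ} (em : ExcludedMiddle ℓ) (ext : Extensionality ℓ ℓ)
  (G : Graph ℓ) (κ : Cardinal ℓ) (infinite : Infinite (Cardinal.Carrier κ))
  (W : WellOrdering (Graph.Vertex G)) (few : FewerEarlierNeighboursThan G κ W) where
  open Graph G
  open Cardinality em ext
  private
    K = Cardinal.Carrier κ
    module W = Order W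

  ℕ≼K : ℕ ≼ K
  ℕ≼K with finite-or-infinite K
  ... | inj₁ (n , f) = contradiction (proj₂ (finite⇒⤖ em n f)) (infinite _)
  ... | inj₂ e = e

  module LargeGraph (V⋠K : ¬ (Vertex ≼ K)) (W₀ : WellOrdering Vertex) (initial : Order.Initial W₀) where
    module W₀ = Order W₀

    Step : Rel Vertex ℓ
    Step u w = u ~ w × w W.< u

    code : ∀ {x w} → Star Step x w → List K
    code ε = []
    code (_◅_ {x} {y} s p) = to (proj₁ (few x)) (y , [ s ]) ∷ code p

    -- From a common start the code retraces the path: through the injection in `few`, each entry
    -- determines the next vertex among the earlier neighbours of the current one.
    code-injective : ∀ {x w w′} (p : Star Step x w) (q : Star Step x w′) → code p ≡ code q → w ≡ w′
    code-injective ε ε _ = refl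
    code-injective (_◅_ {x} s p) (s′ ◅ q) eq with List.∷-injective eq
    ... | eq₁ , eq₂ with cong value (injective (proj₁ (few x)) eq₁)
    ... | refl = code-injective p q eq₂

    root-spec : ∀ v → ∃[ r ] (Star Step r v × (∀ y → Star Step y v → ¬ (y W₀.< r)))
    root-spec v = minimum W₀ (λ x → Star Step x v) ε

    root : Vertex → Vertex
    root v = proj₁ (root-spec v)

    path : ∀ v → Star Step (root v) v
    path v = proj₁ (proj₂ (root-spec v))

    W′ : WellOrdering Vertex
    W′ = pullback (mk↣ {to = λ v → root v , v} ,-injectiveʳ) (lexicographic W₀ W)

    module W′ = Order W′

    earlier : ∀ {v w} → v ~ w → w W′.< v → w W.< v
    earlier _ (inj₂ (_ , w<v)) = w<v
    earlier {v} {w} v~w (inj₁ rw<rv) with W.compare w v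
    ... | tri< w<v _ _ = w<v
    ... | tri≈ _ w≡v _ = contradiction v~w (~-irrefl (sym w≡v))
    -- Prolonging the path to `w` by the step from `w` to `v` makes `root w` a candidate for
    -- `root v`.
    ... | tri> _ _ v<w = contradiction rw<rv
            (proj₂ (proj₂ (root-spec v)) (root w) (path w ◅◅ ((~-sym v~w , v<w) ◅ ε)))

    few′ : FewerEarlierNeighboursThan G κ W′
    few′ v = (proj₁ (few v) ↣-∘ E′≼E) , λ f → proj₂ (few v) (E′≼E ↣-∘ f)
      where
      E′≼E : EarlierNeighbours G W′ v ≼ EarlierNeighbours G W v
      E′≼E = mk↣ {to = λ { (w , [ p ]) → w , [ (proj₁ p , earlier (proj₁ p) (proj₂ p)) ] }}
        (value-injective ∘ cong value)

    root-mono : ∀ {x y} → y W′.< x → ¬ (root x W₀.< root y)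
    root-mono (inj₁ ry<rx) = W₀.asym ry<rx
    root-mono (inj₂ (ry≡rx , _)) = W₀.irrefl (sym ry≡rx)

    root-code-injective : ∀ {y z} → root y ≡ root z → code (path y) ≡ code (path z) → y ≡ z
    -- Roots and paths are generalised together, so that matching on the equality of roots gives the
    -- paths a common start.
    root-code-injective {y} {z} ry≡rz with root y | path y | root z | path z
    root-code-injective refl | _ | p | _ | q = code-injective p q

    -- A root and a code determine the vertex. The segment is closed because vertices before `x` may
    -- share its root.
    segment≼ : ∀ x → W′.Segment x ≼ (W₀.ClosedSegment (root x) × List K)
    segment≼ x = mk↣ {to = locate} λ {y} {z} eq → value-injective
      (root-code-injective {value y} {value z} (cong (value ∘ proj₁) eq) (cong proj₂ eq))
      where
      locate : W′.Segment x → W₀.ClosedSegment (root x) × List K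
      locate (y , [ y<x ]) = (root y , [ root-mono {x} {y} y<x ]) , code (path y)

    initial′ : W′.Initial
    initial′ x f with ≼-total {B = K} (pullback (W₀.closedSegment⊂ (root x)) W₀)
    -- With the roots embedded into `K`, every vertex is coded by a list over `K`, hence by an
    -- element of `K`.
    ... | inj₁ g = V⋠K (infinite⇒List≼ (Cardinal.wellOrdering κ) ℕ≼K
            ↣-∘ (×-List≼ ↣-∘ ((g ×-↣ mk↣ id) ↣-∘ (segment≼ x ↣-∘ f))))
    -- With `K` embedded into the closed segment, lists over that segment absorb the codes, and
    -- `Vertex` lands in a proper segment of `W₀`.
    ... | inj₂ g = initial (root x) (closedSegment≼segment W₀ (root x) e
            ↣-∘ (infinite⇒List≼ (pullback (W₀.closedSegment⊂ (root x)) W₀) e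
            ↣-∘ (×-List≼ ↣-∘ ((mk↣ id ×-↣ List-≼ g) ↣-∘ (segment≼ x ↣-∘ f)))))
      where
      e = g ↣-∘ ℕ≼K
      List-≼ : {A B : Set ℓ} → A ≼ B → List A ≼ List B
      List-≼ h = mk↣ (List.map-injective (injective h))

  good-initial-ordering : Σ[ W′ ∈ WellOrdering Vertex ] (FewerEarlierNeighboursThan G κ W′ × Order.Initial W′)
  good-initial-ordering with initial-ordering W | em {Vertex ≼ K}
  ... | W₀ , initial | no V⋠K = W′ , few′ , initial′
    where open LargeGraph V⋠K W₀ initial
  ... | W₀ , initial | yes V≼K = W₀ , few₀ , initial
    where
    open Order W₀
    few₀ : FewerEarlierNeighboursThan G κ W₀
    -- An embedding of `K` into the earlier neighbours would carry `Vertex` into a proper segment of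
    -- `W₀`.
    few₀ v = (V≼K ↣-∘ (segment⊂ v ↣-∘ E≼S)) , λ K≼E → initial v (E≼S ↣-∘ (K≼E ↣-∘ V≼K))
      where
      E≼S : EarlierNeighbours G W₀ v ≼ Segment v
      E≼S = mk↣ {to = λ { (w , [ p ]) → w , [ proj₂ p ] }} (value-injective ∘ cong value)

theorem1p3 : ∀ {ℓ} → ExcludedMiddle (suc ℓ) → Extensionality (suc ℓ) (suc ℓ) →
    (G : Graph ℓ) (κ : Cardinal ℓ) → IsColouringNumber G κ → Infinite (Cardinal.Carrier κ) →
    ∃[ W ] (Good G W × (∃[ μ ] (μ IsCardinalityOf (Graph.Vertex G) × W HasOrderType μ)))
theorem1p3 {ℓ} em ext G κ col infinite
  with W , few ← IsColouringNumber.attained col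
  with W′ , few′ , initial ← good-initial-ordering (lower-em em)
         (lower-extensionality (suc ℓ) (suc ℓ) ext) G κ infinite W few
  = W′ , (κ , col , few′)
  -- The vertex set ordered by `W′` is itself the cardinal, so the bijection and the order
  -- isomorphism are identities.
  , record { Carrier = Graph.Vertex G ; wellOrdering = W′ ; initial = λ x f → initial x (⤖⇒≽ f) }
  , mk⤖ (id , λ y → y , id)
  , id , Identity.isOrderIsomorphism _≡_ (WellOrdering._<_ W′) refl
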